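{- Let $p>3$ be a prime, $f(x)\in\mathbb{Z}[x]$, and let $\sigma$ be a cycle of $f_1$ (i.e. of $f$ mod $p$) which grows. Then its unique lift, a cycle of $f_2$, also grows.
   Context: $f_n:\mathbb{Z}/p^n\mathbb{Z}\to\mathbb{Z}/p^n\mathbb{Z}$ is the map $x\mapsto f(x)\bmod p^n$. Let $\sigma=(x_1,\dots,x_k)$ be a cycle of $f_n$ of length $k$ (distinct elements, $f_n(x_i)=x_{i+1}$, $f_n(x_k)=x_1$), with the $x_i$ viewed as integers representing their classes. Put $g=f^k$ ($k$-th iterate), $a_n=g'(x_1)$, $b_n=(g(x_1)-x_1)/p^n$. A lift of $\sigma$ is a cycle of $f_{n+1}$ all of whose elements reduce mod $p^n$ to elements of $\sigma$. The cycle $\sigma$ grows if $a_n\equiv1\pmod p$ and $b_n\not\equiv0\pmod p$ (this is independent of the choices); in that case the elements of $\mathbb{Z}/p^{n+1}\mathbb{Z}$ reducing to elements of $\sigma$ form a single cycle of $f_{n+1}$, of length $pk$, which is the unique lift of $\sigma$. -}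

module Defs where

open import Data.Fin using (Fin; zero; suc; inject₁; fromℕ)
open import Data.Integer using (ℤ; +_; 0ℤ; 1ℤ; _+_; _*_; _-_; -_; _/ℕ_)
open import Data.Integer.Divisibility.Signed using (_∣_; divides; ∣m∣n⇒∣m+n; ∣m⇒∣-m; ∣n⇒∣m*n; ∣m⇒∣m*n)
open import Data.Integer.Tactic.RingSolver using (solve-∀)
open import Data.List using (List; []; _∷_; [_]; map)
open import Data.Nat as ℕ using (ℕ; zero; suc; _^_)
open import Data.Nat.Properties using (m^n≢0)
open import Data.Product using (∃-syntax; _×_)
open import Function using (Func; Injective)
open import Level using (0ℓ)
open import Relation.Binary.Bundles using (Setoid)
open import Relation.Binary.PropositionalEquality using (_≡_; refl; sym; subst)
open import Relation.Nullary using (¬_)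

-- Integer polynomials as coefficient lists, constant coefficient first
-- (trailing zeros allowed).
ℤ[x] : Set
ℤ[x] = List ℤ

eval : ℤ[x] → ℤ → ℤ
eval []      x = 0ℤ
eval (c ∷ q) x = c + x * eval q x

infixl 6 _⊕_
infixl 7 _⊗_

_⊕_ : ℤ[x] → ℤ[x] → ℤ[x]
[]      ⊕ r       = r
(c ∷ q) ⊕ []      = c ∷ q
(c ∷ q) ⊕ (d ∷ r) = (c + d) ∷ (q ⊕ r)

_⊗_ : ℤ[x] → ℤ[x] → ℤ[x]
[]      ⊗ r = []
(c ∷ q) ⊗ r = map (c *_) r ⊕ (0ℤ ∷ q ⊗ r)

-- (c + x q)′ = q + x q′
derivative : ℤ[x] → ℤ[x]
derivative []      = []
derivative (c ∷ q) = q ⊕ (0ℤ ∷ derivative q)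

compose : ℤ[x] → ℤ[x] → ℤ[x]
compose []      r = []
compose (c ∷ q) r = [ c ] ⊕ r ⊗ compose q r

-- The k-fold composition f ∘ ⋯ ∘ f, not the k-th power.
iterate : ℤ[x] → ℕ → ℤ[x]
iterate f zero    = 0ℤ ∷ 1ℤ ∷ []
iterate f (suc k) = compose f (iterate f k)

infix 4 _≡_[mod_]

_≡_[mod_] : ℤ → ℤ → ℕ → Set
x ≡ y [mod m ] = + m ∣ x - y

-- ℤ/mℤ: an element is given by any integer representing its class.
ℤ/_ℤ : ℕ → Setoid 0ℓ 0ℓ
ℤ/ m ℤ = record
  { Carrier       = ℤ
  ; _≈_           = λ x y → x ≡ y [mod m ]
  ; isEquivalence = record
    { refl  = λ {x} → divides 0ℤ (refl′ x)
    ; sym   = λ {x} {y} x≡y → subst (+ m ∣_) (sym′ x y) (∣m⇒∣-m x≡y)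
    ; trans = λ {x} {y} {z} x≡y y≡z →
        subst (+ m ∣_) (trans′ x y z) (∣m∣n⇒∣m+n x≡y y≡z)
    }
  }
  where
  refl′ : ∀ x → x - x ≡ 0ℤ
  refl′ = solve-∀
  sym′ : ∀ x y → - (x - y) ≡ y - x
  sym′ = solve-∀
  trans′ : ∀ x y z → (x - y) + (y - z) ≡ x - z
  trans′ = solve-∀

eval-cong : ∀ (m : ℕ) (f : ℤ[x]) {x y} →
            x ≡ y [mod m ] → eval f x ≡ eval f y [mod m ]
eval-cong m []      x≡y = divides 0ℤ refl
eval-cong m (c ∷ q) {x} {y} x≡y =
  subst (+ m ∣_) (split c x y (eval q x) (eval q y))
    (∣m∣n⇒∣m+n (∣m⇒∣m*n (eval q x) x≡y) (∣n⇒∣m*n y (eval-cong m q x≡y)))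
  where
  split : ∀ c x y s t → (x - y) * s + y * (s - t) ≡ (c + x * s) - (c + y * t)
  split = solve-∀

reduce : (p n : ℕ) → ℤ[x] → Func (ℤ/ p ^ n ℤ) (ℤ/ p ^ n ℤ)
reduce p n f = record { to = eval f ; cong = eval-cong (p ^ n) f }

-- A cycle together with a choice of first element and of representatives.
-- The length is suc last, so that cycles are nonempty.
record Cycle {S : Setoid 0ℓ 0ℓ} (h : Func S S) : Set where
  open Setoid S using (Carrier; _≈_)
  field
    last     : ℕ
    elem     : Fin (suc last) → Carrier
    distinct : Injective _≡_ _≈_ elem
    step     : ∀ (i : Fin last) → Func.to h (elem (inject₁ i)) ≈ elem (suc i)
    close    : Func.to h (elem (fromℕ last)) ≈ elem zero

  length : ℕ
  length = suc last

-- Equality of cycles up to the choice of first element and representatives: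
-- a cycle is determined by its set of elements, since h fixes their order.
infix 4 _≈ᶜ_

_≈ᶜ_ : {S : Setoid 0ℓ 0ℓ} {h : Func S S} → Cycle h → Cycle h → Set
_≈ᶜ_ {S} σ τ =
    (∀ i → ∃[ j ] Cycle.elem σ i ≈ Cycle.elem τ j)
  × (∀ j → ∃[ i ] Cycle.elem τ j ≈ Cycle.elem σ i)
  where open Setoid S using (_≈_)

module _ (p n : ℕ) (f : ℤ[x]) where

  IsLift : Cycle (reduce p n f) → Cycle (reduce p (suc n) f) → Set
  IsLift σ τ = ∀ j → ∃[ i ] Cycle.elem τ j ≡ Cycle.elem σ i [mod p ^ n ]

  module _ (σ : Cycle (reduce p n f)) where
    open Cycle σ

    private
      x₁ : ℤ
      x₁ = elem zero

      g : ℤ[x]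
      g = iterate f length

    aCoeff : ℤ
    aCoeff = eval (derivative g) x₁

    -- The division is exact, because σ is a cycle modulo p ^ n.
    bCoeff : .{{ℕ.NonZero p}} → ℤ
    bCoeff = (eval g x₁ - x₁) /ℕ (p ^ n)
      where instance _ = m^n≢0 p n

    Grows : .{{ℕ.NonZero p}} → Set
    Grows = (aCoeff ≡ 1ℤ [mod p ]) × ¬ (bCoeff ≡ 0ℤ [mod p ])

{-# OPTIONS --safe #-}
module Submission where

-- Let k be the length of σ, x₀ its first element, g = fᵏ and g(x₀) = x₀ + p b.
-- Since g′(x₀) ≡ 1 mod p, modulo p² the map g translates the residue class of x₀:
-- g(x₀ + p t) ≡ x₀ + p (t + b).  As p ∤ b, g permutes the p lifts of x₀ cyclically,
-- so the lift of σ is unique and has length p k.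
--
-- Modulo p³ a second-order Taylor expansion with g′(z) = 1 + p α and c = g″(z)/2 gives
--   gʲ(z) ≡ z + p (j b + p (α b Σ i + c b² Σ i²)),  the sums over i < j.
-- For j = p both sums are divisible by p, because p > 3, so gᵖ(z) ≡ z + p² b mod p³.

open import Defs
open import Data.Nat using (ℕ; NonZero; _>_)
open import Data.Nat.Primality using (Prime)
open import Data.Product using (_×_; ∃!)

open import Data.Fin using (Fin; zero; suc; toℕ; fromℕ; fromℕ<; inject₁)
open import Data.Fin.Induction using (<-weakInduction)
open import Data.Fin.Properties using (toℕ-inject₁; toℕ-fromℕ; toℕ-fromℕ<; toℕ<n; toℕ-injective)
open import Data.Integer as ℤ using (ℤ; +_; 0ℤ; 1ℤ; _+_; _*_; _-_; -_; _/ℕ_; _%ℕ_)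
import Data.Integer.Coprimality as ℤ
open import Data.Integer.Divisibility.Signed
  using (_∣_; divides; ∣ᵤ⇒∣; ∣⇒∣ᵤ; ∣-refl; ∣-trans; ∣m⇒∣m*n; ∣n⇒∣m*n; ∣m+n∣n⇒∣m; *-cancelˡ-∣; *-monoʳ-∣)
open import Data.Integer.DivMod using (a≡a%ℕn+[a/ℕn]*n; n%ℕd<d)
import Data.Integer.Properties as ℤ
open import Data.Integer.Tactic.RingSolver using (solve-∀)
open import Data.List using ([]; _∷_; [_]; map)
open import Data.Nat as ℕ using (zero; suc; _^_; _∸_; _%_; _/_)
open import Data.Nat.Coprimality using (prime⇒coprime; coprime-Bézout)
import Data.Nat.Divisibility as ℕ
import Data.Nat.DivMod as ℕ
open import Data.Nat.GCD using (module Bézout)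
import Data.Nat.Properties as ℕ
open import Data.Product using (∃; ∃-syntax; _,_; proj₁; proj₂)
open import Data.Sum using (inj₁; inj₂)
open import Function using (Func; Injective)
import Function.Endo.Propositional as Endo
open import Level using (0ℓ)
open import Relation.Binary.Bundles using (Setoid)
open import Relation.Binary.PropositionalEquality
  using (_≡_; refl; sym; trans; cong; cong₂; subst; subst₂; cong-app; module ≡-Reasoning)
import Relation.Binary.Reasoning.Setoid as SetoidReasoning
open import Relation.Nullary using (¬_)

-- Evaluation and Taylor expansion of polynomials

eval-⊕ : ∀ q r x → eval (q ⊕ r) x ≡ eval q x + eval r x
eval-⊕ []      r       x = sym (ℤ.+-identityˡ _)
eval-⊕ (c ∷ q) []      x = sym (ℤ.+-identityʳ _)
eval-⊕ (c ∷ q) (d ∷ r) x = begin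
  (c + d) + x * eval (q ⊕ r) x         ≡⟨ cong (λ s → c + d + x * s) (eval-⊕ q r x) ⟩
  (c + d) + x * (eval q x + eval r x)  ≡⟨ rearrange c d x (eval q x) (eval r x) ⟩
  (c + x * eval q x) + (d + x * eval r x) ∎
  where
  open ≡-Reasoning
  rearrange : ∀ c d x s t → (c + d) + x * (s + t) ≡ (c + x * s) + (d + x * t)
  rearrange = solve-∀

eval-scale : ∀ c q x → eval (map (c *_) q) x ≡ c * eval q x
eval-scale c []      x = sym (ℤ.*-zeroʳ c)
eval-scale c (d ∷ q) x = begin
  c * d + x * eval (map (c *_) q) x ≡⟨ cong (λ s → c * d + x * s) (eval-scale c q x) ⟩
  c * d + x * (c * eval q x)        ≡⟨ rearrange c d x (eval q x) ⟩
  c * (d + x * eval q x)            ∎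
  where
  open ≡-Reasoning
  rearrange : ∀ c d x s → c * d + x * (c * s) ≡ c * (d + x * s)
  rearrange = solve-∀

eval-⊗ : ∀ q r x → eval (q ⊗ r) x ≡ eval q x * eval r x
eval-⊗ []      r x = refl
eval-⊗ (c ∷ q) r x = begin
  eval (map (c *_) r ⊕ (0ℤ ∷ q ⊗ r)) x
    ≡⟨ eval-⊕ (map (c *_) r) (0ℤ ∷ q ⊗ r) x ⟩
  eval (map (c *_) r) x + (0ℤ + x * eval (q ⊗ r) x)
    ≡⟨ cong₂ (λ s t → s + (0ℤ + x * t)) (eval-scale c r x) (eval-⊗ q r x) ⟩
  c * eval r x + (0ℤ + x * (eval q x * eval r x))
    ≡⟨ rearrange c x (eval q x) (eval r x) ⟩
  (c + x * eval q x) * eval r x ∎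
  where
  open ≡-Reasoning
  rearrange : ∀ c x s t → c * t + (0ℤ + x * (s * t)) ≡ (c + x * s) * t
  rearrange = solve-∀

eval-compose : ∀ q r x → eval (compose q r) x ≡ eval q (eval r x)
eval-compose []      r x = refl
eval-compose (c ∷ q) r x = begin
  eval ([ c ] ⊕ r ⊗ compose q r) x
    ≡⟨ eval-⊕ [ c ] (r ⊗ compose q r) x ⟩
  (c + x * 0ℤ) + eval (r ⊗ compose q r) x
    ≡⟨ cong (λ s → (c + x * 0ℤ) + s) (eval-⊗ r (compose q r) x) ⟩
  (c + x * 0ℤ) + eval r x * eval (compose q r) x
    ≡⟨ cong (λ s → (c + x * 0ℤ) + eval r x * s) (eval-compose q r x) ⟩
  (c + x * 0ℤ) + eval r x * eval q (eval r x)
    ≡⟨ rearrange c x (eval r x) (eval q (eval r x)) ⟩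
  c + eval r x * eval q (eval r x) ∎
  where
  open ≡-Reasoning
  rearrange : ∀ c x s t → (c + x * 0ℤ) + s * t ≡ c + s * t
  rearrange = solve-∀

infixr 8 _^∘_

_^∘_ : {A : Set} → (A → A) → ℕ → A → A
_^∘_ {A} = Endo._^_ A

^∘-+ : {A : Set} (F : A → A) (m n : ℕ) (x : A) → (F ^∘ (m ℕ.+ n)) x ≡ (F ^∘ m) ((F ^∘ n) x)
^∘-+ {A} F m n = cong-app (Endo.^-homo A F m n)

^∘-comm : {A : Set} (F : A → A) (m n : ℕ) (x : A) → (F ^∘ m) ((F ^∘ n) x) ≡ (F ^∘ n) ((F ^∘ m) x)
^∘-comm F m n x = begin
  (F ^∘ m) ((F ^∘ n) x) ≡⟨ ^∘-+ F m n x ⟨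
  (F ^∘ (m ℕ.+ n)) x    ≡⟨ cong (λ i → (F ^∘ i) x) (ℕ.+-comm m n) ⟩
  (F ^∘ (n ℕ.+ m)) x    ≡⟨ ^∘-+ F n m x ⟩
  (F ^∘ n) ((F ^∘ m) x) ∎
  where open ≡-Reasoning

-- The polynomial `iterate f k` is there for its derivative, whereas orbits are followed with
-- function iterates; this links the two.
eval-iterate : ∀ f k x → eval (iterate f k) x ≡ (eval f ^∘ k) x
eval-iterate f zero    x = identity x
  where
  identity : ∀ x → 0ℤ + x * (1ℤ + x * 0ℤ) ≡ x
  identity = solve-∀
eval-iterate f (suc k) x =
  trans (eval-compose f (iterate f k) x) (cong (eval f) (eval-iterate f k x))

-- Here `c` is half the second derivative at `x`, obtained by recursion so that nothing is divided
-- by 2. It is chosen before `h`, so one `c` serves all displacements; only the cubic remainder `r`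
-- varies, and it disappears modulo p³ once p divides `h`.
taylor : ∀ q x → ∃[ c ] ∀ h → ∃[ r ]
         eval q (x + h) ≡ eval q x + h * eval (derivative q) x + h * h * c + h * h * h * r
taylor []      x = 0ℤ , λ h → 0ℤ , zeros h
  where
  zeros : ∀ h → 0ℤ ≡ 0ℤ + h * 0ℤ + h * h * 0ℤ + h * h * h * 0ℤ
  zeros = solve-∀
taylor (d ∷ q) x with taylor q x
-- Both witnesses are read off from `x + h` times the expansion of `q`: the h² terms are `q′` and
-- `x * c`, and the rest is h³ times `c + (x + h) * r`.
... | c , expand = q′ + x * c , λ h → let r , eq = expand h in c + (x + h) * r , (begin
  d + (x + h) * eval q (x + h)
    ≡⟨ cong (λ s → d + (x + h) * s) eq ⟩
  d + (x + h) * (eval q x + h * q′ + h * h * c + h * h * h * r)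
    ≡⟨ rearrange d x h (eval q x) q′ c r ⟩
  d + x * eval q x + h * (eval q x + (0ℤ + x * q′)) + h * h * (q′ + x * c)
    + h * h * h * (c + (x + h) * r)
    ≡⟨ cong (λ s → d + x * eval q x + h * s + h * h * (q′ + x * c) + h * h * h * (c + (x + h) * r))
            (eval-⊕ q (0ℤ ∷ derivative q) x) ⟨
  d + x * eval q x + h * eval (derivative (d ∷ q)) x + h * h * (q′ + x * c)
    + h * h * h * (c + (x + h) * r) ∎)
  where
  open ≡-Reasoning
  q′ : ℤ
  q′ = eval (derivative q) x
  rearrange : ∀ d x h s q′ c r →
    d + (x + h) * (s + h * q′ + h * h * c + h * h * h * r)
      ≡ d + x * s + h * (s + (0ℤ + x * q′)) + h * h * (q′ + x * c) + h * h * h * (c + (x + h) * r)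
  rearrange = solve-∀

-- Cycles as periodic orbits

module _ {S : Setoid 0ℓ 0ℓ} (h : Func S S) where
  open Setoid S using (_≈_) renaming (refl to ≈-refl; sym to ≈-sym; reflexive to ≈-reflexive)
  open Func h using () renaming (to to F; cong to F-cong)
  open SetoidReasoning S

  ^∘-cong : ∀ n {x y} → x ≈ y → (F ^∘ n) x ≈ (F ^∘ n) y
  ^∘-cong zero    x≈y = x≈y
  ^∘-cong (suc n) x≈y = F-cong (^∘-cong n x≈y)

  return-multiple : ∀ {x} m n → (F ^∘ n) x ≈ x → (F ^∘ (m ℕ.* n)) x ≈ x
  return-multiple     zero    n Fx≈x = ≈-refl
  return-multiple {x} (suc m) n Fx≈x = begin
    (F ^∘ (n ℕ.+ m ℕ.* n)) x       ≡⟨ ^∘-+ F n (m ℕ.* n) x ⟩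
    (F ^∘ n) ((F ^∘ (m ℕ.* n)) x)  ≈⟨ ^∘-cong n (return-multiple m n Fx≈x) ⟩
    (F ^∘ n) x                     ≈⟨ Fx≈x ⟩
    x                              ∎

  ^∘-% : ∀ {x} n .{{_ : NonZero n}} → (F ^∘ n) x ≈ x → ∀ d → (F ^∘ d) x ≈ (F ^∘ (d % n)) x
  ^∘-% {x} n Fx≈x d = begin
    (F ^∘ d) x                                  ≡⟨ cong (λ i → (F ^∘ i) x) (ℕ.m≡m%n+[m/n]*n d n) ⟩
    (F ^∘ (d % n ℕ.+ d / n ℕ.* n)) x            ≡⟨ ^∘-+ F (d % n) (d / n ℕ.* n) x ⟩
    (F ^∘ (d % n)) ((F ^∘ (d / n ℕ.* n)) x)     ≈⟨ ^∘-cong (d % n) (return-multiple (d / n) n Fx≈x) ⟩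
    (F ^∘ (d % n)) x                            ∎

  -- Iterates of `F` commute, so a period of a point is a period of every later point of its orbit.
  return-transport : ∀ {x y} s n → y ≈ (F ^∘ s) x → (F ^∘ n) x ≈ x → (F ^∘ n) y ≈ y
  return-transport {x} {y} s n y≈ Fx≈x = begin
    (F ^∘ n) y            ≈⟨ ^∘-cong n y≈ ⟩
    (F ^∘ n) ((F ^∘ s) x) ≡⟨ ^∘-comm F n s x ⟩
    (F ^∘ s) ((F ^∘ n) x) ≈⟨ ^∘-cong s Fx≈x ⟩
    (F ^∘ s) x            ≈⟨ y≈ ⟨
    y                     ∎

  -- `F` need not be invertible, so the way back is found by going forward: `s * n` is a multiple of
  -- the period and at least `s`, and the remaining `s * n ∸ s` steps close the loop.
  come-back : ∀ {x y} s n .{{_ : NonZero n}} → (F ^∘ n) x ≈ x → y ≈ (F ^∘ s) x →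
              ∃[ c ] x ≈ (F ^∘ c) y
  come-back {x} {y} s n Fx≈x y≈ = s ℕ.* n ∸ s , (begin
    x                                      ≈⟨ return-multiple s n Fx≈x ⟨
    (F ^∘ (s ℕ.* n)) x                     ≡⟨ cong (λ i → (F ^∘ i) x) (ℕ.m∸n+n≡m (ℕ.m≤m*n s n)) ⟨
    (F ^∘ (s ℕ.* n ∸ s ℕ.+ s)) x           ≡⟨ ^∘-+ F (s ℕ.* n ∸ s) s x ⟩
    (F ^∘ (s ℕ.* n ∸ s)) ((F ^∘ s) x)      ≈⟨ ^∘-cong (s ℕ.* n ∸ s) y≈ ⟨
    (F ^∘ (s ℕ.* n ∸ s)) y                 ∎)

  -- Since `x` is periodic, some iterate leads from Fⁱ(x) back to `x`, which cancels the first `i`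
  -- steps. Then `j ∸ i` is a return time below `n` and divisible by `n`, hence zero.
  orbit-injective : ∀ {x} n .{{_ : NonZero n}} → (F ^∘ n) x ≈ x → (∀ d → (F ^∘ d) x ≈ x → n ℕ.∣ d) →
                    ∀ {i j} → i ℕ.≤ j → j ℕ.< n → (F ^∘ i) x ≈ (F ^∘ j) x → i ≡ j
  orbit-injective {x} n Fx≈x minimal {i} {j} i≤j j<n eq =
    ℕ.≤-antisym i≤j (ℕ.m∸n≡0⇒m≤n (trans (sym (ℕ.m<n⇒m%n≡m j-i<n)) (ℕ.n∣m⇒m%n≡0 _ n (minimal _ returns))))
    where
    j-i<n : j ∸ i ℕ.< n
    j-i<n = ℕ.≤-<-trans (ℕ.m∸n≤m j i) j<n
    returns : (F ^∘ (j ∸ i)) x ≈ x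
    returns with come-back i n Fx≈x ≈-refl
    ... | c , x≈ = begin
      (F ^∘ (j ∸ i)) x                         ≈⟨ ^∘-cong (j ∸ i) x≈ ⟩
      (F ^∘ (j ∸ i)) ((F ^∘ c) ((F ^∘ i) x))   ≡⟨ ^∘-comm F (j ∸ i) c _ ⟩
      (F ^∘ c) ((F ^∘ (j ∸ i)) ((F ^∘ i) x))   ≡⟨ cong (F ^∘ c) (^∘-+ F (j ∸ i) i x) ⟨
      (F ^∘ c) ((F ^∘ (j ∸ i ℕ.+ i)) x)        ≡⟨ cong (λ l → (F ^∘ c) ((F ^∘ l) x)) (ℕ.m∸n+n≡m i≤j) ⟩
      (F ^∘ c) ((F ^∘ j) x)                    ≈⟨ ^∘-cong c eq ⟨
      (F ^∘ c) ((F ^∘ i) x)                    ≈⟨ x≈ ⟨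
      x                                        ∎

  orbitCycle : ∀ x l → (F ^∘ suc l) x ≈ x → (∀ d → (F ^∘ d) x ≈ x → suc l ℕ.∣ d) → Cycle h
  orbitCycle x l Fx≈x minimal = record
    { last     = l
    ; elem     = λ i → (F ^∘ toℕ i) x
    ; distinct = distinct
    ; step     = λ i → ≈-reflexive (cong (λ j → F ((F ^∘ j) x)) (toℕ-inject₁ i))
    ; close    = begin
        F ((F ^∘ toℕ (fromℕ l)) x)  ≡⟨ cong (λ j → F ((F ^∘ j) x)) (toℕ-fromℕ l) ⟩
        (F ^∘ suc l) x                       ≈⟨ Fx≈x ⟩
        x                                    ∎
    }
    where
    distinct : Injective _≡_ _≈_ (λ (i : Fin (suc l)) → (F ^∘ toℕ i) x)
    distinct {i} {j} eq with ℕ.≤-total (toℕ i) (toℕ j)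
    ... | inj₁ i≤j = toℕ-injective (orbit-injective (suc l) Fx≈x minimal i≤j (toℕ<n j) eq)
    ... | inj₂ j≤i = sym (toℕ-injective (orbit-injective (suc l) Fx≈x minimal j≤i (toℕ<n i) (≈-sym eq)))

  module _ (τ : Cycle h) where
    open Cycle τ

    elem-orbit : ∀ i → elem i ≈ (F ^∘ toℕ i) (elem zero)
    elem-orbit = <-weakInduction (λ i → elem i ≈ (F ^∘ toℕ i) (elem zero)) ≈-refl λ i elem-i → begin
      elem (suc i)                                      ≈⟨ step i ⟨
      F (elem (inject₁ i))                     ≈⟨ F-cong elem-i ⟩
      F ((F ^∘ toℕ (inject₁ i)) (elem zero))   ≡⟨ cong (λ j → F ((F ^∘ j) (elem zero))) (toℕ-inject₁ i) ⟩
      F ((F ^∘ toℕ i) (elem zero))                      ∎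

    cycle-return : (F ^∘ length) (elem zero) ≈ elem zero
    cycle-return = begin
      F ((F ^∘ last) (elem zero))                         ≡⟨ cong (λ j → F ((F ^∘ j) (elem zero))) (toℕ-fromℕ last) ⟨
      F ((F ^∘ toℕ (fromℕ last)) (elem zero))    ≈⟨ F-cong (elem-orbit (fromℕ last)) ⟨
      F (elem (fromℕ last))                      ≈⟨ close ⟩
      elem zero                                           ∎

    private
      position : ℕ → Fin length
      position d = fromℕ< (ℕ.m%n<n d length)

    orbit-elem : ∀ d → ∃[ i ] (F ^∘ d) (elem zero) ≈ elem i
    orbit-elem d = position d , (begin
      (F ^∘ d) (elem zero)                   ≈⟨ ^∘-% length cycle-return d ⟩
      (F ^∘ (d % length)) (elem zero)        ≡⟨ cong (λ i → (F ^∘ i) (elem zero)) (toℕ-fromℕ< (ℕ.m%n<n d length)) ⟨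
      (F ^∘ toℕ (position d)) (elem zero)    ≈⟨ elem-orbit (position d) ⟨
      elem (position d)                      ∎)

    -- After `d` steps the orbit is at position `d % length`, and distinctness of the elements makes
    -- this position zero.
    length∣return : ∀ d → (F ^∘ d) (elem zero) ≈ elem zero → length ℕ.∣ d
    length∣return d Fx≈x = ℕ.m%n≡0⇒n∣m d length
      (trans (sym (toℕ-fromℕ< (ℕ.m%n<n d length))) (cong toℕ (distinct (begin
        elem (position d)      ≈⟨ proj₂ (orbit-elem d) ⟨
        (F ^∘ d) (elem zero)   ≈⟨ Fx≈x ⟩
        elem zero              ∎))))

  orbit-⊆ : (τ ρ : Cycle h) → ∀ s → Cycle.elem τ zero ≈ (F ^∘ s) (Cycle.elem ρ zero) →
            ∀ i → ∃[ j ] Cycle.elem τ i ≈ Cycle.elem ρ j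
  orbit-⊆ τ ρ s τ₀≈ i with orbit-elem ρ (toℕ i ℕ.+ s)
  ... | j , ≈elem-j = j , (begin
    Cycle.elem τ i                                    ≈⟨ elem-orbit τ i ⟩
    (F ^∘ toℕ i) (Cycle.elem τ zero)                  ≈⟨ ^∘-cong (toℕ i) τ₀≈ ⟩
    (F ^∘ toℕ i) ((F ^∘ s) (Cycle.elem ρ zero))       ≡⟨ ^∘-+ F (toℕ i) s _ ⟨
    (F ^∘ (toℕ i ℕ.+ s)) (Cycle.elem ρ zero)          ≈⟨ ≈elem-j ⟩
    Cycle.elem ρ j                                    ∎)

  -- One meeting point suffices: by periodicity the start of `ρ` is also on the orbit of `τ`, and
  -- each inclusion follows by iterating from the start.
  meet⇒≈ᶜ : (ρ τ : Cycle h) → ∀ s → Cycle.elem τ zero ≈ (F ^∘ s) (Cycle.elem ρ zero) → ρ ≈ᶜ τ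
  meet⇒≈ᶜ ρ τ s τ₀≈ with come-back s (Cycle.length ρ) (cycle-return ρ) τ₀≈
  ... | c , ρ₀≈ = orbit-⊆ ρ τ c ρ₀≈ , orbit-⊆ τ ρ s τ₀≈

-- Congruences

-- `M` is the modulus in a form suited to ring identities, such as `P * P` for `+ (p ^ 2)`.
mod-intro : ∀ {m M} → + m ≡ M → ∀ {x y} q → x ≡ y + M * q → x ≡ y [mod m ]
mod-intro {m} refl {y = y} q refl = divides q (cancel y (+ m) q)
  where
  cancel : ∀ y M q → (y + M * q) - y ≡ q * M
  cancel = solve-∀

+-multiple : ∀ {m M} → + m ≡ M → ∀ y q → y + M * q ≡ y [mod m ]
+-multiple {M = M} M≡ y q = mod-intro M≡ {y + M * q} {y} q refl

mod-refl : ∀ m x → x ≡ x [mod m ]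
mod-refl m x = Setoid.refl (ℤ/ m ℤ) {x}

mod-sym : ∀ m x y → x ≡ y [mod m ] → y ≡ x [mod m ]
mod-sym m x y = Setoid.sym (ℤ/ m ℤ) {x} {y}

mod-trans : ∀ m x y z → x ≡ y [mod m ] → y ≡ z [mod m ] → x ≡ z [mod m ]
mod-trans m x y z = Setoid.trans (ℤ/ m ℤ) {x} {y} {z}

mod-elim : ∀ {m M} → + m ≡ M → ∀ x y → x ≡ y [mod m ] → ∃[ q ] x ≡ y + M * q
mod-elim {m} refl x y (divides q eq) = q , (begin
  x            ≡⟨ restore x y ⟩
  y + (x - y)  ≡⟨ cong (λ s → y + s) eq ⟩
  y + q * + m  ≡⟨ cong (λ s → y + s) (ℤ.*-comm q (+ m)) ⟩
  y + + m * q  ∎)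
  where
  open ≡-Reasoning
  restore : ∀ x y → x ≡ y + (x - y)
  restore = solve-∀

mod-^-pred : ∀ p n x y → x ≡ y [mod p ^ suc n ] → x ≡ y [mod p ^ n ]
mod-^-pred p n x y = ∣-trans (∣ᵤ⇒∣ (ℕ.n∣m*n p))

+-congʳ-mod : ∀ m z x y → x ≡ y [mod m ] → x + z ≡ y + z [mod m ]
+-congʳ-mod m z x y = subst (+ m ∣_) (shift x y z)
  where
  shift : ∀ x y z → x - y ≡ (x + z) - (y + z)
  shift = solve-∀

*-congˡ-mod : ∀ m z {x y} → x ≡ y [mod m ] → z * x ≡ z * y [mod m ]
*-congˡ-mod m z {x} {y} x≡y = subst (+ m ∣_) (distrib x y z) (∣n⇒∣m*n z x≡y)
  where
  distrib : ∀ x y z → z * (x - y) ≡ z * x - z * y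
  distrib = solve-∀

≡0-mod⇒∣ : ∀ {m} n → + n ≡ 0ℤ [mod m ] → m ℕ.∣ n
≡0-mod⇒∣ {m} n n≡0 = ∣⇒∣ᵤ (subst (+ m ∣_) (ℤ.+-identityʳ (+ n)) n≡0)

/ℕ-exact : ∀ n .{{_ : NonZero n}} i → + n ∣ i → i ≡ + n * (i /ℕ n)
/ℕ-exact n i n∣i = begin
  i                          ≡⟨ a≡a%ℕn+[a/ℕn]*n i n ⟩
  + (i %ℕ n) + i /ℕ n * + n  ≡⟨ cong (λ r → + r + i /ℕ n * + n) remainder≡0 ⟩
  0ℤ + i /ℕ n * + n          ≡⟨ ℤ.+-identityˡ _ ⟩
  i /ℕ n * + n               ≡⟨ ℤ.*-comm (i /ℕ n) (+ n) ⟩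
  + n * (i /ℕ n)             ∎
  where
  open ≡-Reasoning
  n∣remainder : n ℕ.∣ i %ℕ n
  n∣remainder = ∣⇒∣ᵤ (∣m+n∣n⇒∣m {m = + (i %ℕ n)} (subst (+ n ∣_) (a≡a%ℕn+[a/ℕn]*n i n) n∣i) (∣n⇒∣m*n (i /ℕ n) ∣-refl))
  remainder≡0 : i %ℕ n ≡ 0
  remainder≡0 = trans (sym (ℕ.m<n⇒m%n≡m (n%ℕd<d i n))) (ℕ.n∣m⇒m%n≡0 _ n n∣remainder)

module _ (p : ℕ) where
  private
    P : ℤ
    P = + p

  pos-^1 : + (p ^ 1) ≡ P
  pos-^1 = cong +_ (ℕ.^-identityʳ p)

  pos-^2 : + (p ^ 2) ≡ P * P
  pos-^2 = trans (ℤ.pos-* p (p ^ 1)) (cong (P *_) pos-^1)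

  pos-^3 : + (p ^ 3) ≡ P * (P * P)
  pos-^3 = trans (ℤ.pos-* p (p ^ 2)) (cong (P *_) pos-^2)

  -- With `shift-cong`, this makes `t` modulo p a coordinate on the lifts `x + P * t` modulo p² of
  -- the class of `x`.
  shift-cancel : .{{_ : NonZero p}} → ∀ x s t → x + P * s ≡ x + P * t [mod p ^ 2 ] → s ≡ t [mod p ]
  shift-cancel x s t eq = *-cancelˡ-∣ P (subst₂ _∣_ pos-^2 (factor x P s t) eq)
    where
    factor : ∀ x P s t → (x + P * s) - (x + P * t) ≡ P * (s - t)
    factor = solve-∀

  shift-cong : ∀ x {s t} → s ≡ t [mod p ] → x + P * s ≡ x + P * t [mod p ^ 2 ]
  shift-cong x {s} {t} s≡t =
    subst₂ _∣_ (sym pos-^2) (expand x P s t) (*-monoʳ-∣ P s≡t)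
    where
    expand : ∀ x P s t → P * (s - t) ≡ (x + P * s) - (x + P * t)
    expand = solve-∀

  -- Bézout is applied to p and the remainder of `b`. Over the naturals its identity has two sign
  -- forms, which give `- + y` or `+ y` as the inverse.
  mod-inverse : .{{_ : NonZero p}} → Prime p → ∀ b → ¬ (b ≡ 0ℤ [mod p ]) → ∃[ u ] u * b ≡ 1ℤ [mod p ]
  mod-inverse p-prime b b≢0 = inverse (coprime-Bézout (prime⇒coprime p-prime {{r≢0}} (n%ℕd<d b p)))
    where
    r : ℕ
    r = b %ℕ p
    q : ℤ
    q = b /ℕ p
    b≡ : b ≡ + r + q * P
    b≡ = a≡a%ℕn+[a/ℕn]*n b p
    r≢0 : NonZero r
    r≢0 = ℕ.≢-nonZero λ r≡0 → b≢0 (mod-intro refl {y = 0ℤ} q (begin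
      b                ≡⟨ b≡ ⟩
      + r + q * P      ≡⟨ cong (λ i → + i + q * P) r≡0 ⟩
      0ℤ + q * P       ≡⟨ cong (λ s → 0ℤ + s) (ℤ.*-comm q P) ⟩
      0ℤ + P * q       ∎))
      where open ≡-Reasoning
    inverse : Bézout.Identity 1 p r → ∃[ u ] u * b ≡ 1ℤ [mod p ]
    inverse (Bézout.+- x y eq) = - + y , mod-intro refl (- + y * q - + x) (begin
      - + y * b                                 ≡⟨ cong (- + y *_) b≡ ⟩
      - + y * (+ r + q * P)                     ≡⟨ rearrange (+ r) q P (+ y) ⟩
      1ℤ + P * (- + y * q) - (1ℤ + + y * + r)   ≡⟨ cong (λ s → 1ℤ + P * (- + y * q) - s) eqℤ ⟩
      1ℤ + P * (- + y * q) - + x * P            ≡⟨ collect P (- + y * q) (+ x) ⟩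
      1ℤ + P * (- + y * q - + x)                ∎)
      where
      open ≡-Reasoning
      eqℤ : 1ℤ + + y * + r ≡ + x * P
      eqℤ = begin
        1ℤ + + y * + r        ≡⟨ cong (λ s → 1ℤ + s) (ℤ.pos-* y r) ⟨
        + (1 ℕ.+ y ℕ.* r)     ≡⟨ cong +_ eq ⟩
        + (x ℕ.* p)           ≡⟨ ℤ.pos-* x p ⟩
        + x * P               ∎
      rearrange : ∀ r q P y → - y * (r + q * P) ≡ 1ℤ + P * (- y * q) - (1ℤ + y * r)
      rearrange = solve-∀
      collect : ∀ P s x → 1ℤ + P * s - x * P ≡ 1ℤ + P * (s - x)
      collect = solve-∀
    inverse (Bézout.-+ x y eq) = + y , mod-intro refl (+ x + + y * q) (begin
      + y * b                          ≡⟨ cong (+ y *_) b≡ ⟩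
      + y * (+ r + q * P)              ≡⟨ rearrange (+ r) q P (+ y) ⟩
      + y * + r + P * (+ y * q)        ≡⟨ cong (λ s → s + P * (+ y * q)) eqℤ ⟨
      1ℤ + + x * P + P * (+ y * q)     ≡⟨ collect P (+ y * q) (+ x) ⟩
      1ℤ + P * (+ x + + y * q)         ∎)
      where
      open ≡-Reasoning
      eqℤ : 1ℤ + + x * P ≡ + y * + r
      eqℤ = begin
        1ℤ + + x * P          ≡⟨ cong (λ s → 1ℤ + s) (ℤ.pos-* x p) ⟨
        + (1 ℕ.+ x ℕ.* p)     ≡⟨ cong +_ eq ⟩
        + (y ℕ.* r)           ≡⟨ ℤ.pos-* y r ⟩
        + y * + r             ∎
      rearrange : ∀ r q P y → y * (r + q * P) ≡ y * r + P * (y * q)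
      rearrange = solve-∀
      collect : ∀ P s x → 1ℤ + x * P + P * s ≡ 1ℤ + P * (x + s)
      collect = solve-∀

  -- Every Taylor term beyond the first order contains the square of `P * t`.
  linearize : ∀ q x t →
    eval q (x + P * t) ≡ eval q x + P * (t * eval (derivative q) x) [mod p ^ 2 ]
  linearize q x t with taylor q x
  ... | c , expand with expand (P * t)
  ... | r , eq = mod-intro pos-^2 (t * t * c + P * t * t * t * r)
      (trans eq (rearrange P t (eval q x) (eval (derivative q) x) c r))
    where
    rearrange : ∀ P t s s′ c r →
      s + P * t * s′ + P * t * (P * t) * c + P * t * (P * t) * (P * t) * r
        ≡ s + P * (t * s′) + P * P * (t * t * c + P * t * t * t * r)
    rearrange = solve-∀

-- Power sums

Σ₁ Σ₂ : ℕ → ℤ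
Σ₁ zero    = 0ℤ
Σ₁ (suc j) = Σ₁ j + + j
Σ₂ zero    = 0ℤ
Σ₂ (suc j) = Σ₂ j + + j * + j

2Σ₁ : ∀ j → + 2 * Σ₁ j ≡ + j * (+ j - 1ℤ)
2Σ₁ zero    = refl
2Σ₁ (suc j) = begin
  + 2 * (Σ₁ j + + j)              ≡⟨ ℤ.*-distribˡ-+ (+ 2) (Σ₁ j) (+ j) ⟩
  + 2 * Σ₁ j + + 2 * + j          ≡⟨ cong (λ s → s + + 2 * + j) (2Σ₁ j) ⟩
  + j * (+ j - 1ℤ) + + 2 * + j    ≡⟨ rearrange (+ j) ⟩
  (1ℤ + + j) * (1ℤ + + j - 1ℤ)    ∎
  where
  open ≡-Reasoning
  rearrange : ∀ j → j * (j - 1ℤ) + + 2 * j ≡ (1ℤ + j) * (1ℤ + j - 1ℤ)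
  rearrange = solve-∀

-- The factor 6 is written as 2 times 3 because each of these is below p and can be cancelled by
-- `prime∣small*`, while 6 itself exceeds p when p = 5.
6Σ₂ : ∀ j → + 2 * (+ 3 * Σ₂ j) ≡ + j * ((+ j - 1ℤ) * (+ 2 * + j - 1ℤ))
6Σ₂ zero    = refl
6Σ₂ (suc j) = begin
  + 2 * (+ 3 * (Σ₂ j + + j * + j))
    ≡⟨ distribute (Σ₂ j) (+ j) ⟩
  + 2 * (+ 3 * Σ₂ j) + + 6 * (+ j * + j)
    ≡⟨ cong (λ s → s + + 6 * (+ j * + j)) (6Σ₂ j) ⟩
  + j * ((+ j - 1ℤ) * (+ 2 * + j - 1ℤ)) + + 6 * (+ j * + j)
    ≡⟨ rearrange (+ j) ⟩
  (1ℤ + + j) * ((1ℤ + + j - 1ℤ) * (+ 2 * (1ℤ + + j) - 1ℤ)) ∎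
  where
  open ≡-Reasoning
  distribute : ∀ s j → + 2 * (+ 3 * (s + j * j)) ≡ + 2 * (+ 3 * s) + + 6 * (j * j)
  distribute = solve-∀
  rearrange : ∀ j → j * ((j - 1ℤ) * (+ 2 * j - 1ℤ)) + + 6 * (j * j)
                    ≡ (1ℤ + j) * ((1ℤ + j - 1ℤ) * (+ 2 * (1ℤ + j) - 1ℤ))
  rearrange = solve-∀

prime∣small* : ∀ {p} → Prime p → ∀ n .{{_ : NonZero n}} → n ℕ.< p → ∀ i → + p ∣ + n * i → + p ∣ i
prime∣small* {p} p-prime n n<p i p∣ni =
  ∣ᵤ⇒∣ (ℤ.coprime-divisor (+ p) (+ n) i (prime⇒coprime p-prime n<p) (∣⇒∣ᵤ p∣ni))

prime∣Σ₁ : ∀ {p} → Prime p → p > 2 → + p ∣ Σ₁ p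
prime∣Σ₁ {p} p-prime p>2 =
  prime∣small* p-prime 2 p>2 _ (subst (+ p ∣_) (sym (2Σ₁ p)) (∣m⇒∣m*n (+ p - 1ℤ) ∣-refl))

-- Here p > 3 is essential: `Σ₂ 3` is 0 + 1 + 4 = 5, which 3 does not divide.
prime∣Σ₂ : ∀ {p} → Prime p → p > 3 → + p ∣ Σ₂ p
prime∣Σ₂ {p} p-prime p>3 =
  prime∣small* p-prime 3 p>3 _ (prime∣small* p-prime 2 (ℕ.<-trans (ℕ.n<1+n 2) p>3) _
    (subst (+ p ∣_) (sym (6Σ₂ p)) (∣m⇒∣m*n _ ∣-refl)))

-- Residue classes on which a polynomial acts as a translation

module _ (p : ℕ) (g : ℤ[x]) (x b : ℤ)
         (gx≡ : eval g x ≡ x + + p * b) (g′x≡1 : eval (derivative g) x ≡ 1ℤ [mod p ]) where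
  private
    P : ℤ
    P = + p

    slope : ∃[ α ] eval (derivative g) x ≡ 1ℤ + P * α
    slope = mod-elim refl (eval (derivative g) x) 1ℤ g′x≡1

  -- The slope differs from 1 by `P * α`, and multiplied by the displacement `P * t` this is a
  -- multiple of p².
  translate : ∀ t → eval g (x + P * t) ≡ x + P * (t + b) [mod p ^ 2 ]
  translate t with slope
  ... | α , g′x≡ = begin
    eval g (x + P * t)                                ≈⟨ linearize p g x t ⟩
    eval g x + P * (t * eval (derivative g) x)        ≡⟨ cong₂ (λ s s′ → s + P * (t * s′)) gx≡ g′x≡ ⟩
    x + P * b + P * (t * (1ℤ + P * α))                ≈⟨ mod-intro (pos-^2 p) (t * α) (rearrange x P b t α) ⟩
    x + P * (t + b)                                   ∎
    where
    open SetoidReasoning (ℤ/ p ^ 2 ℤ)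
    rearrange : ∀ x P b t α → x + P * b + P * (t * (1ℤ + P * α)) ≡ x + P * (t + b) + P * P * (t * α)
    rearrange = solve-∀

  translate-iterate : ∀ m t → (eval g ^∘ m) (x + P * t) ≡ x + P * (t + + m * b) [mod p ^ 2 ]
  translate-iterate zero    t = Setoid.reflexive (ℤ/ p ^ 2 ℤ) (rearrange x P t b)
    where
    rearrange : ∀ x P t b → x + P * t ≡ x + P * (t + 0ℤ * b)
    rearrange = solve-∀
  translate-iterate (suc m) t = begin
    eval g ((eval g ^∘ m) (x + P * t))   ≈⟨ eval-cong (p ^ 2) g (translate-iterate m t) ⟩
    eval g (x + P * (t + + m * b))       ≈⟨ translate (t + + m * b) ⟩
    x + P * (t + + m * b + b)            ≡⟨ rearrange x P t (+ m) b ⟩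
    x + P * (t + (1ℤ + + m) * b)         ∎
    where
    open SetoidReasoning (ℤ/ p ^ 2 ℤ)
    rearrange : ∀ x P t m b → x + P * (t + m * b + b) ≡ x + P * (t + (1ℤ + m) * b)
    rearrange = solve-∀

  -- By induction, the displacement `P * T j` is inserted into the Taylor expansion. Modulo p, `T j`
  -- is `j b`, so at order p² the slope adds `α b j` and the quadratic term adds `c b² j²`: these
  -- are the increments of the two sums. The cubic term vanishes.
  iterate-mod-p³ : ∃[ α ] ∃[ c ] ∀ j →
    (eval g ^∘ j) x ≡ x + P * (+ j * b + P * (α * b * Σ₁ j + c * b * b * Σ₂ j)) [mod p ^ 3 ]
  iterate-mod-p³ with slope | taylor g x
  ... | α , g′x≡ | c , expand = α , c , go
    where
    open SetoidReasoning (ℤ/ p ^ 3 ℤ)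
    U T : ℕ → ℤ
    U j = α * b * Σ₁ j + c * b * b * Σ₂ j
    T j = + j * b + P * U j
    initial : ∀ x P b α c → x ≡ x + P * (0ℤ * b + P * (α * b * 0ℤ + c * b * b * 0ℤ))
    initial = solve-∀
    rearrange : ∀ x P b α c j U r →
      let T = j * b + P * U in
      x + P * b + P * T * (1ℤ + P * α) + P * T * (P * T) * c + P * T * (P * T) * (P * T) * r
        ≡ x + P * ((1ℤ + j) * b + P * (U + (α * b * j + c * b * b * (j * j))))
          + P * (P * P) * (U * α + c * (+ 2 * j * b * U + P * U * U) + T * T * T * r)
    rearrange = solve-∀
    regroup : ∀ α b c j s₁ s₂ →
      α * b * s₁ + c * b * b * s₂ + (α * b * j + c * b * b * (j * j))
        ≡ α * b * (s₁ + j) + c * b * b * (s₂ + j * j)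
    regroup = solve-∀
    go : ∀ j → (eval g ^∘ j) x ≡ x + P * T j [mod p ^ 3 ]
    go zero    = Setoid.reflexive (ℤ/ p ^ 3 ℤ) (initial x P b α c)
    go (suc j) with expand (P * T j)
    ... | r , eq = begin
      eval g ((eval g ^∘ j) x)
        ≈⟨ eval-cong (p ^ 3) g (go j) ⟩
      eval g (x + P * T j)
        ≡⟨ eq ⟩
      eval g x + P * T j * eval (derivative g) x + P * T j * (P * T j) * c
        + P * T j * (P * T j) * (P * T j) * r
        ≡⟨ cong₂ (λ s s′ → s + P * T j * s′ + P * T j * (P * T j) * c
                             + P * T j * (P * T j) * (P * T j) * r) gx≡ g′x≡ ⟩
      x + P * b + P * T j * (1ℤ + P * α) + P * T j * (P * T j) * c
        + P * T j * (P * T j) * (P * T j) * r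
        ≈⟨ mod-intro (pos-^3 p) _ (rearrange x P b α c (+ j) (U j) r) ⟩
      x + P * (+ suc j * b + P * (U j + (α * b * + j + c * b * b * (+ j * + j))))
        ≡⟨ cong (λ u → x + P * (+ suc j * b + P * u)) (regroup α b c (+ j) (Σ₁ j) (Σ₂ j)) ⟩
      x + P * T (suc j) ∎

  iterate-p : Prime p → p > 3 → (eval g ^∘ p) x ≡ x + P * P * b [mod p ^ 3 ]
  iterate-p p-prime p>3
    with iterate-mod-p³ | prime∣Σ₁ p-prime (ℕ.<-trans (ℕ.n<1+n 2) p>3) | prime∣Σ₂ p-prime p>3
  ... | α , c , formula | divides s₁ Σ₁≡ | divides s₂ Σ₂≡ = begin
    (eval g ^∘ p) x
      ≈⟨ formula p ⟩
    x + P * (P * b + P * (α * b * Σ₁ p + c * b * b * Σ₂ p))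
      ≡⟨ cong₂ (λ s t → x + P * (P * b + P * (α * b * s + c * b * b * t))) Σ₁≡ Σ₂≡ ⟩
    x + P * (P * b + P * (α * b * (s₁ * P) + c * b * b * (s₂ * P)))
      ≈⟨ mod-intro (pos-^3 p) (α * b * s₁ + c * b * b * s₂) (rearrange x P b α c s₁ s₂) ⟩
    x + P * P * b ∎
    where
    open SetoidReasoning (ℤ/ p ^ 3 ℤ)
    rearrange : ∀ x P b α c s₁ s₂ →
      x + P * (P * b + P * (α * b * (s₁ * P) + c * b * b * (s₂ * P)))
        ≡ x + P * P * b + P * (P * P) * (α * b * s₁ + c * b * b * s₂)
    rearrange = solve-∀

-- Iterates of f, and growth as a property of a residue class

iterate-^∘ : ∀ f k m x → (eval (iterate f k) ^∘ m) x ≡ (eval f ^∘ (m ℕ.* k)) x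
iterate-^∘ f k zero    x = refl
iterate-^∘ f k (suc m) x = begin
  eval (iterate f k) ((eval (iterate f k) ^∘ m) x)   ≡⟨ cong (eval (iterate f k)) (iterate-^∘ f k m x) ⟩
  eval (iterate f k) ((eval f ^∘ (m ℕ.* k)) x)       ≡⟨ eval-iterate f k _ ⟩
  (eval f ^∘ k) ((eval f ^∘ (m ℕ.* k)) x)            ≡⟨ ^∘-+ (eval f) k (m ℕ.* k) x ⟨
  (eval f ^∘ (k ℕ.+ m ℕ.* k)) x                      ∎
  where open ≡-Reasoning

module _ (p : ℕ) (f : ℤ[x]) where

  -- Used in `aCoeff-lift`, where derivatives of iterates are compared through their effect on
  -- displacements, in place of the chain rule.
  linearize-^∘ : ∀ n x t → (eval f ^∘ n) (x + + p * t)
    ≡ (eval f ^∘ n) x + + p * (t * eval (derivative (iterate f n)) x) [mod p ^ 2 ]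
  linearize-^∘ n x t = begin
    (eval f ^∘ n) (x + + p * t)
      ≡⟨ eval-iterate f n _ ⟨
    eval (iterate f n) (x + + p * t)
      ≈⟨ linearize p (iterate f n) x t ⟩
    eval (iterate f n) x + + p * (t * eval (derivative (iterate f n)) x)
      ≡⟨ cong (λ s → s + + p * (t * eval (derivative (iterate f n)) x)) (eval-iterate f n x) ⟩
    (eval f ^∘ n) x + + p * (t * eval (derivative (iterate f n)) x) ∎
    where open SetoidReasoning (ℤ/ p ^ 2 ℤ)

  /-difference : ∀ n .{{_ : NonZero (p ^ n)}} k x → (eval f ^∘ k) x ≡ x [mod p ^ n ] →
    eval (iterate f k) x ≡ x + + (p ^ n) * ((eval (iterate f k) x - x) /ℕ (p ^ n))
  /-difference n k x Fx≡x = trans (restore (eval (iterate f k) x) x)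
    (cong (λ s → x + s) (/ℕ-exact (p ^ n) _ (subst (λ y → + (p ^ n) ∣ y - x) (sym (eval-iterate f k x)) Fx≡x)))
    where
    restore : ∀ x y → x ≡ y + (x - y)
    restore = solve-∀

-- Growth is recorded at a point instead of a cycle, with `β` an exact integer quotient, so that the
-- same data serve modulo p² and modulo p³.
GrowingAt : ℕ → ℤ[x] → ℤ → ℤ → Set
GrowingAt p g z β =
  (eval g z ≡ z + + p * β) × (eval (derivative g) z ≡ 1ℤ [mod p ]) × ¬ (β ≡ 0ℤ [mod p ])

growing-base : ∀ p .{{_ : NonZero p}} f (σ : Cycle (reduce p 1 f)) → Grows p 1 f σ →
               GrowingAt p (iterate f (Cycle.length σ)) (Cycle.elem σ zero) (bCoeff p 1 f σ)
growing-base p f σ (a≡1 , b≢0) =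
  trans (/-difference p f 1 length x₀ (cycle-return (reduce p 1 f) σ))
        (cong (λ M → x₀ + M * bCoeff p 1 f σ) (pos-^1 p)) ,
  a≡1 , b≢0
  where
  open Cycle σ using (length; elem)
  x₀ : ℤ
  x₀ = elem zero
  instance _ = ℕ.m^n≢0 p 1

-- With z = x₀ + p t, translation modulo p² gives g(z) = z + p (b + p q) for some q, so the new
-- quotient is still `b` modulo p; the derivative modulo p depends only on the class.
growing-class : ∀ p g x₀ b → GrowingAt p g x₀ b → ∀ z → z ≡ x₀ [mod p ] → ∃ (GrowingAt p g z)
growing-class p g x₀ b (gx₀ , g′x₀ , b≢0) z z≡x₀ with mod-elim refl z x₀ z≡x₀
... | t , refl with mod-elim (pos-^2 p) _ _ (translate p g x₀ b gx₀ g′x₀ t)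
... | q , gz≡ = b + + p * q , trans gz≡ (rearrange x₀ (+ p) t b q) , (begin
        eval (derivative g) z   ≈⟨ eval-cong p (derivative g) z≡x₀ ⟩
        eval (derivative g) x₀  ≈⟨ g′x₀ ⟩
        1ℤ                      ∎) , λ b′≡0 → b≢0 (begin
        b             ≈⟨ +-multiple refl b q ⟨
        b + + p * q   ≈⟨ b′≡0 ⟩
        0ℤ            ∎)
  where
  open SetoidReasoning (ℤ/ p ℤ)
  rearrange : ∀ x P t b q → x + P * (t + b) + P * P * q ≡ x + P * t + P * (b + P * q)
  rearrange = solve-∀

-- The lift of a growing cycle modulo p

module _ (p : ℕ) .{{_ : NonZero p}} (p-prime : Prime p) (p>3 : p > 3)
         (f : ℤ[x]) (σ : Cycle (reduce p 1 f)) (b : ℤ)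
         (growing-x₀ : GrowingAt p (iterate f (Cycle.length σ)) (Cycle.elem σ zero) b) where
  private
    P : ℤ
    P = + p

    F : ℤ → ℤ
    F = eval f

    k : ℕ
    k = Cycle.length σ

    g : ℤ[x]
    g = iterate f k

    x₀ : ℤ
    x₀ = Cycle.elem σ zero

    p¹⇒p : ∀ x y → x ≡ y [mod p ^ 1 ] → x ≡ y [mod p ]
    p¹⇒p x y = subst (λ m → x ≡ y [mod m ]) (ℕ.^-identityʳ p)

  -- All points of the class are treated, not only `x₀`: an arbitrary lift comes with its own
  -- representatives, which match the orbit of `x₀` only modulo p².
  class-mod-p³ : ∀ z → z ≡ x₀ [mod p ] →
    ∃[ β ] ((F ^∘ (p ℕ.* k)) z ≡ z + P * P * β [mod p ^ 3 ]) × ¬ (β ≡ 0ℤ [mod p ])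
  class-mod-p³ z z≡x₀ =
    let β , gz , g′z , β≢0 = growing-class p g x₀ b growing-x₀ z z≡x₀ in
    β , subst (λ y → y ≡ z + P * P * β [mod p ^ 3 ])
          (iterate-^∘ f k p z) (iterate-p p g z β gz g′z p-prime p>3) , β≢0

  class-return-mod-p² : ∀ z → z ≡ x₀ [mod p ] → (F ^∘ (p ℕ.* k)) z ≡ z [mod p ^ 2 ]
  class-return-mod-p² z z≡x₀ = let β , eq , _ = class-mod-p³ z z≡x₀ in begin
    (F ^∘ (p ℕ.* k)) z   ≈⟨ mod-^-pred p 2 ((F ^∘ (p ℕ.* k)) z) (z + P * P * β) eq ⟩
    z + P * P * β        ≈⟨ +-multiple (pos-^2 p) z β ⟩
    z                    ∎
    where open SetoidReasoning (ℤ/ p ^ 2 ℤ)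

  -- A return would make p² β divisible by p³; cancelling p twice contradicts that p does not divide
  -- β.
  class-no-return-mod-p³ : ∀ z → z ≡ x₀ [mod p ] → ¬ ((F ^∘ (p ℕ.* k)) z ≡ z [mod p ^ 3 ])
  class-no-return-mod-p³ z z≡x₀ returns = proj₂ (proj₂ (class-mod-p³ z z≡x₀)) (shift-cancel p z β 0ℤ (*-cancelˡ-∣ P
          (subst₂ _∣_ (trans (pos-^3 p) (cong (P *_) (sym (pos-^2 p)))) (factor z P β) z+P²β≡z)))
    where
    open SetoidReasoning (ℤ/ p ^ 3 ℤ)
    β : ℤ
    β = proj₁ (class-mod-p³ z z≡x₀)
    z+P²β≡z : z + P * P * β ≡ z [mod p ^ 3 ]
    z+P²β≡z = begin
      z + P * P * β         ≈⟨ proj₁ (proj₂ (class-mod-p³ z z≡x₀)) ⟨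
      (F ^∘ (p ℕ.* k)) z    ≈⟨ returns ⟩
      z                     ∎
    factor : ∀ z P β → z + P * P * β - z ≡ P * ((z + P * β) - (z + P * 0ℤ))
    factor = solve-∀

  -- The orbit of the first element modulo p²

  multiples-of-k : ∀ m t → (F ^∘ (m ℕ.* k)) (x₀ + P * t) ≡ x₀ + P * (t + + m * b) [mod p ^ 2 ]
  multiples-of-k m t = let gx₀ , g′x₀ , _ = growing-x₀ in subst (λ y → y ≡ x₀ + P * (t + + m * b) [mod p ^ 2 ])
          (iterate-^∘ f k m (x₀ + P * t)) (translate-iterate p g x₀ b gx₀ g′x₀ m t)

  multiples-of-k-x₀ : ∀ m → (F ^∘ (m ℕ.* k)) x₀ ≡ x₀ + P * (+ m * b) [mod p ^ 2 ]
  multiples-of-k-x₀ m = begin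
    (F ^∘ (m ℕ.* k)) x₀              ≡⟨ cong (F ^∘ (m ℕ.* k)) (pad x₀ P) ⟩
    (F ^∘ (m ℕ.* k)) (x₀ + P * 0ℤ)   ≈⟨ multiples-of-k m 0ℤ ⟩
    x₀ + P * (0ℤ + + m * b)          ≡⟨ cong (λ s → x₀ + P * s) (ℤ.+-identityˡ (+ m * b)) ⟩
    x₀ + P * (+ m * b)               ∎
    where
    open SetoidReasoning (ℤ/ p ^ 2 ℤ)
    pad : ∀ x P → x ≡ x + P * 0ℤ
    pad = solve-∀

  -- After `m * k` steps the coordinate of `x₀` has moved by `m b`, which must vanish modulo p, and
  -- `b` is invertible.
  return-p∣ : ∀ m → (F ^∘ (m ℕ.* k)) x₀ ≡ x₀ [mod p ^ 2 ] → p ℕ.∣ m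
  return-p∣ m returns = ≡0-mod⇒∣ m (begin
    + m               ≡⟨ ℤ.*-identityʳ (+ m) ⟨
    + m * 1ℤ          ≈⟨ *-congˡ-mod p (+ m) (proj₂ inverse) ⟨
    + m * (u * b)     ≡⟨ swap (+ m) u b ⟩
    u * (+ m * b)     ≈⟨ *-congˡ-mod p u mb≡0 ⟩
    u * 0ℤ            ≡⟨ ℤ.*-zeroʳ u ⟩
    0ℤ                ∎)
    where
    open SetoidReasoning (ℤ/ p ℤ)
    inverse : ∃[ u ] u * b ≡ 1ℤ [mod p ]
    inverse = mod-inverse p p-prime b (proj₂ (proj₂ growing-x₀))
    u : ℤ
    u = proj₁ inverse
    swap : ∀ m u b → m * (u * b) ≡ u * (m * b)
    swap = solve-∀
    pad : ∀ x P → x ≡ x + P * 0ℤ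
    pad = solve-∀
    mb≡0 : + m * b ≡ 0ℤ [mod p ]
    mb≡0 = shift-cancel p x₀ (+ m * b) 0ℤ (R.begin
      x₀ + P * (+ m * b)    R.≈⟨ multiples-of-k-x₀ m ⟨
      (F ^∘ (m ℕ.* k)) x₀   R.≈⟨ returns ⟩
      x₀                    R.≡⟨ pad x₀ P ⟩
      x₀ + P * 0ℤ           R.∎)
      where module R = SetoidReasoning (ℤ/ p ^ 2 ℤ)

  -- A return modulo p² is also one modulo p, so `d` is a multiple `m * k`; then `return-p∣` applies
  -- to `m`.
  return-divisible : ∀ d → (F ^∘ d) x₀ ≡ x₀ [mod p ^ 2 ] → p ℕ.* k ℕ.∣ d
  return-divisible d returns = subst (p ℕ.* k ℕ.∣_) (sym d≡m*k)
    (ℕ.*-monoˡ-∣ k (return-p∣ m (subst (λ n → (F ^∘ n) x₀ ≡ x₀ [mod p ^ 2 ]) d≡m*k returns)))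
    where
    open ℕ._∣_ (length∣return (reduce p 1 f) σ d (mod-^-pred p 1 ((F ^∘ d) x₀) x₀ returns))
      renaming (quotient to m; equality to d≡m*k)

  class-orbit : ∀ z → z ≡ x₀ [mod p ] → ∃[ m ] z ≡ (F ^∘ (m ℕ.* k)) x₀ [mod p ^ 2 ]
  class-orbit z z≡x₀ = m , (begin
    z                                ≡⟨ proj₂ offset ⟩
    x₀ + P * t                       ≈⟨ shift-cong p x₀ {+ m * b} {t} mb≡t ⟨
    x₀ + P * (+ m * b)               ≈⟨ multiples-of-k-x₀ m ⟨
    (F ^∘ (m ℕ.* k)) x₀              ∎)
    where
    open SetoidReasoning (ℤ/ p ^ 2 ℤ)
    offset : ∃[ t ] z ≡ x₀ + P * t
    offset = mod-elim refl z x₀ z≡x₀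
    inverse : ∃[ u ] u * b ≡ 1ℤ [mod p ]
    inverse = mod-inverse p p-prime b (proj₂ (proj₂ growing-x₀))
    t u : ℤ
    t = proj₁ offset
    u = proj₁ inverse
    m : ℕ
    -- The solution of m b ≡ t modulo p, reduced to a natural number so that it can count
    -- iterations.
    m = (t * u) %ℕ p
    mb≡t : + m * b ≡ t [mod p ]
    mb≡t = R.begin
      + m * b                             R.≈⟨ mod-intro refl {y = + m * b} ((t * u) /ℕ p * b) (expand (+ m) ((t * u) /ℕ p) P b) ⟨
      (+ m + (t * u) /ℕ p * P) * b        R.≡⟨ cong (_* b) (a≡a%ℕn+[a/ℕn]*n (t * u) p) ⟨
      t * u * b                           R.≡⟨ ℤ.*-assoc t u b ⟩
      t * (u * b)                         R.≈⟨ *-congˡ-mod p t (proj₂ inverse) ⟩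
      t * 1ℤ                              R.≡⟨ ℤ.*-identityʳ t ⟩
      t                                   R.∎
      where
      module R = SetoidReasoning (ℤ/ p ℤ)
      expand : ∀ m q P b → (m + q * P) * b ≡ m * b + P * (q * b)
      expand = solve-∀

  -- Existence of the lift

  private
    instance
      pk≢0 : NonZero (p ℕ.* k)
      pk≢0 = ℕ.m*n≢0 p k

  canonicalLift : Cycle (reduce p 2 f)
  -- A `Cycle` stores its length minus one, hence `ℕ.pred`.
  canonicalLift = orbitCycle (reduce p 2 f) x₀ (ℕ.pred (p ℕ.* k))
    (subst (λ n → (F ^∘ n) x₀ ≡ x₀ [mod p ^ 2 ]) (sym (ℕ.suc-pred (p ℕ.* k))) (class-return-mod-p² x₀ (mod-refl p x₀)))
    (λ d returns → subst (ℕ._∣ d) (sym (ℕ.suc-pred (p ℕ.* k))) (return-divisible d returns))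

  canonicalLift-isLift : IsLift p 1 f σ canonicalLift
  canonicalLift-isLift j = orbit-elem (reduce p 1 f) σ (toℕ j)

  -- Uniqueness and growth of an arbitrary lift

  module _ (τ : Cycle (reduce p 2 f)) (τ-lift : IsLift p 1 f σ τ) where
    private
      y₀ : ℤ
      y₀ = Cycle.elem τ zero

      N : ℕ
      N = Cycle.length τ

    -- Modulo p, `e` steps lead from `y₀` into the class of `x₀`. All of that class lies on the
    -- orbit of `x₀` modulo p², and `c` further steps around `τ` lead back to `y₀`.
    lift-meets-orbit : ∃[ s ] y₀ ≡ (F ^∘ s) x₀ [mod p ^ 2 ]
    lift-meets-orbit = c ℕ.+ m ℕ.* k , (begin
      y₀                                 ≈⟨ proj₂ from-z ⟩
      (F ^∘ c) z                         ≈⟨ ^∘-cong (reduce p 2 f) c (proj₂ z-orbit) ⟩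
      (F ^∘ c) ((F ^∘ (m ℕ.* k)) x₀)     ≡⟨ ^∘-+ F c (m ℕ.* k) x₀ ⟨
      (F ^∘ (c ℕ.+ m ℕ.* k)) x₀          ∎)
      where
      open SetoidReasoning (ℤ/ p ^ 2 ℤ)
      i : Fin k
      i = proj₁ (τ-lift zero)
      y₀≡Fⁱx₀ : y₀ ≡ (F ^∘ toℕ i) x₀ [mod p ^ 1 ]
      y₀≡Fⁱx₀ = mod-trans (p ^ 1) y₀ (Cycle.elem σ i) ((F ^∘ toℕ i) x₀)
        (proj₂ (τ-lift zero)) (elem-orbit (reduce p 1 f) σ i)
      to-x₀ : ∃[ e ] x₀ ≡ (F ^∘ e) y₀ [mod p ^ 1 ]
      to-x₀ = come-back (reduce p 1 f) (toℕ i) k (cycle-return (reduce p 1 f) σ) y₀≡Fⁱx₀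
      e : ℕ
      e = proj₁ to-x₀
      z : ℤ
      z = (F ^∘ e) y₀
      z-orbit : ∃[ m ] z ≡ (F ^∘ (m ℕ.* k)) x₀ [mod p ^ 2 ]
      z-orbit = class-orbit z (p¹⇒p z x₀ (mod-sym (p ^ 1) x₀ z (proj₂ to-x₀)))
      m : ℕ
      m = proj₁ z-orbit
      from-z : ∃[ c ] y₀ ≡ (F ^∘ c) z [mod p ^ 2 ]
      from-z = come-back (reduce p 2 f) e N (cycle-return (reduce p 2 f) τ) (mod-refl (p ^ 2) z)
      c : ℕ
      c = proj₁ from-z

    lift-unique : canonicalLift ≈ᶜ τ
    lift-unique = meet⇒≈ᶜ (reduce p 2 f) canonicalLift τ (proj₁ lift-meets-orbit) (proj₂ lift-meets-orbit)

    private
      s : ℕ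
      s = proj₁ lift-meets-orbit

      y₀≡ : y₀ ≡ (F ^∘ s) x₀ [mod p ^ 2 ]
      y₀≡ = proj₂ lift-meets-orbit

      back : ∃[ c ] x₀ ≡ (F ^∘ c) y₀ [mod p ^ 2 ]
      back = come-back (reduce p 2 f) s (p ℕ.* k) (class-return-mod-p² x₀ (mod-refl p x₀)) y₀≡

      c : ℕ
      c = proj₁ back

      x₀≡ : x₀ ≡ (F ^∘ c) y₀ [mod p ^ 2 ]
      x₀≡ = proj₂ back

      Fᶜy₀≡x₀ : (F ^∘ c) y₀ ≡ x₀ [mod p ]
      Fᶜy₀≡x₀ = p¹⇒p ((F ^∘ c) y₀) x₀ (mod-^-pred p 1 ((F ^∘ c) y₀) x₀ (mod-sym (p ^ 2) x₀ ((F ^∘ c) y₀) x₀≡))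

    -- The points `x₀` and `y₀` are on each other's orbits, so each inherits the periods of the
    -- other.
    length-lift : N ≡ p ℕ.* k
    length-lift = ℕ.∣-antisym
      (length∣return (reduce p 2 f) τ (p ℕ.* k)
        (return-transport (reduce p 2 f) s (p ℕ.* k) y₀≡ (class-return-mod-p² x₀ (mod-refl p x₀))))
      (return-divisible N (return-transport (reduce p 2 f) c N x₀≡ (cycle-return (reduce p 2 f) τ)))

    -- If p divided the coefficient, `y₀` would return after `N` steps even modulo p³, and so would
    -- every later point of its orbit.
    bCoeff-lift : ¬ (bCoeff p 2 f τ ≡ 0ℤ [mod p ])
    -- The contradiction is drawn at Fᶜ(y₀), not at `x₀`: the two are known to agree only modulo p²,
    -- but both lie in the class covered by `class-no-return-mod-p³`.
    bCoeff-lift b≡0 = class-no-return-mod-p³ ((F ^∘ c) y₀) Fᶜy₀≡x₀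
          (return-transport (reduce p 3 f) c (p ℕ.* k) (mod-refl (p ^ 3) ((F ^∘ c) y₀))
            (subst (λ n → (F ^∘ n) y₀ ≡ y₀ [mod p ^ 3 ]) length-lift returns))
      where
      instance _ = ℕ.m^n≢0 p 2
      open ≡-Reasoning
      quotient : ∃[ q ] bCoeff p 2 f τ ≡ 0ℤ + P * q
      quotient = mod-elim refl (bCoeff p 2 f τ) 0ℤ b≡0
      q : ℤ
      q = proj₁ quotient
      rearrange : ∀ y P q → y + P * P * (0ℤ + P * q) ≡ y + P * (P * P) * q
      rearrange = solve-∀
      returns : (F ^∘ N) y₀ ≡ y₀ [mod p ^ 3 ]
      returns = mod-intro (pos-^3 p) q (begin
        (F ^∘ N) y₀                          ≡⟨ eval-iterate f N y₀ ⟨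
        eval (iterate f N) y₀                ≡⟨ /-difference p f 2 N y₀ (cycle-return (reduce p 2 f) τ) ⟩
        y₀ + + (p ^ 2) * bCoeff p 2 f τ      ≡⟨ cong₂ (λ M β → y₀ + M * β) (pos-^2 p) (proj₂ quotient) ⟩
        y₀ + P * P * (0ℤ + P * q)            ≡⟨ rearrange y₀ P q ⟩
        y₀ + P * (P * P) * q                 ∎)

    -- fˢ carries x₀ to y₀ and x₀ + p to y₀ + p E modulo p², and fᴺ fixes both images, so
    -- E A ≡ E mod p; fᶜ carries them back, so D inverts E.
    aCoeff-lift : aCoeff p 2 f τ ≡ 1ℤ [mod p ]
    aCoeff-lift = begin
      A              ≡⟨ ℤ.*-identityʳ A ⟨
      A * 1ℤ         ≈⟨ *-congˡ-mod p A ED≡1 ⟨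
      A * (E * D)    ≡⟨ permute A E D ⟩
      D * (E * A)    ≈⟨ *-congˡ-mod p D EA≡E ⟩
      D * E          ≡⟨ ℤ.*-comm D E ⟩
      E * D          ≈⟨ ED≡1 ⟩
      1ℤ             ∎
      where
      open SetoidReasoning (ℤ/ p ℤ)
      module R = SetoidReasoning (ℤ/ p ^ 2 ℤ)
      A D E x₁ : ℤ
      A = aCoeff p 2 f τ
      D = eval (derivative (iterate f c)) y₀
      E = eval (derivative (iterate f s)) x₀
      x₁ = x₀ + P * 1ℤ
      permute : ∀ A E D → A * (E * D) ≡ D * (E * A)
      permute = solve-∀

      x₁-return : (F ^∘ (p ℕ.* k)) x₁ ≡ x₁ [mod p ^ 2 ]
      x₁-return = class-return-mod-p² x₁ (+-multiple refl x₀ 1ℤ)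

      Fˢx₁≡ : (F ^∘ s) x₁ ≡ y₀ + P * E [mod p ^ 2 ]
      Fˢx₁≡ = R.begin
        (F ^∘ s) x₁                     R.≈⟨ linearize-^∘ p f s x₀ 1ℤ ⟩
        (F ^∘ s) x₀ + P * (1ℤ * E)      R.≡⟨ cong (λ e → (F ^∘ s) x₀ + P * e) (ℤ.*-identityˡ E) ⟩
        (F ^∘ s) x₀ + P * E             R.≈⟨ +-congʳ-mod (p ^ 2) (P * E) y₀ ((F ^∘ s) x₀) y₀≡ ⟨
        y₀ + P * E                      R.∎

      EA≡E : E * A ≡ E [mod p ]
      EA≡E = shift-cancel p y₀ (E * A) E (R.begin
        y₀ + P * (E * A)                R.≈⟨ +-congʳ-mod (p ^ 2) (P * (E * A)) ((F ^∘ N) y₀) y₀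
                                              (cycle-return (reduce p 2 f) τ) ⟨
        (F ^∘ N) y₀ + P * (E * A)       R.≈⟨ linearize-^∘ p f N y₀ E ⟨
        (F ^∘ N) (y₀ + P * E)           R.≡⟨ cong (λ n → (F ^∘ n) (y₀ + P * E)) length-lift ⟩
        (F ^∘ (p ℕ.* k)) (y₀ + P * E)   R.≈⟨ return-transport (reduce p 2 f) s (p ℕ.* k)
                                              (mod-sym (p ^ 2) ((F ^∘ s) x₁) (y₀ + P * E) Fˢx₁≡) x₁-return ⟩
        y₀ + P * E                      R.∎)

      -- The round trip brings back `x₀`, so its length is a multiple of `p * k`; this is also a
      -- period of `x₁`, which therefore comes back too.
      s+c-divisible : p ℕ.* k ℕ.∣ c ℕ.+ s
      s+c-divisible = return-divisible (c ℕ.+ s) (R.begin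
        (F ^∘ (c ℕ.+ s)) x₀             R.≡⟨ ^∘-+ F c s x₀ ⟩
        (F ^∘ c) ((F ^∘ s) x₀)          R.≈⟨ ^∘-cong (reduce p 2 f) c y₀≡ ⟨
        (F ^∘ c) y₀                     R.≈⟨ x₀≡ ⟨
        x₀                              R.∎)

      round-trip : (F ^∘ c) ((F ^∘ s) x₁) ≡ x₁ [mod p ^ 2 ]
      round-trip = R.begin
        (F ^∘ c) ((F ^∘ s) x₁)          R.≡⟨ ^∘-+ F c s x₁ ⟨
        (F ^∘ (c ℕ.+ s)) x₁             R.≡⟨ cong (λ n → (F ^∘ n) x₁) c+s≡ ⟩
        (F ^∘ (q ℕ.* (p ℕ.* k))) x₁     R.≈⟨ return-multiple (reduce p 2 f) q (p ℕ.* k) x₁-return ⟩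
        x₁                              R.∎
        where open ℕ._∣_ s+c-divisible renaming (quotient to q; equality to c+s≡)

      ED≡1 : E * D ≡ 1ℤ [mod p ]
      ED≡1 = shift-cancel p x₀ (E * D) 1ℤ (R.begin
        x₀ + P * (E * D)                R.≈⟨ +-congʳ-mod (p ^ 2) (P * (E * D)) x₀ ((F ^∘ c) y₀) x₀≡ ⟩
        (F ^∘ c) y₀ + P * (E * D)       R.≈⟨ linearize-^∘ p f c y₀ E ⟨
        (F ^∘ c) (y₀ + P * E)           R.≈⟨ ^∘-cong (reduce p 2 f) c Fˢx₁≡ ⟨
        (F ^∘ c) ((F ^∘ s) x₁)          R.≈⟨ round-trip ⟩
        x₁                              R.∎)

mainTheorem4 : (p : ℕ) .{{_ : NonZero p}} → Prime p → p > 3 →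
    (f : ℤ[x]) (σ : Cycle (reduce p 1 f)) → Grows p 1 f σ →
    ∃! _≈ᶜ_ (IsLift p 1 f σ) × ((τ : Cycle (reduce p 2 f)) → IsLift p 1 f σ τ → Grows p 2 f τ)
mainTheorem4 p p-prime p>3 f σ σ-grows =
  ( canonicalLift p p-prime p>3 f σ b growing
  , canonicalLift-isLift p p-prime p>3 f σ b growing
  , λ {τ} → lift-unique p p-prime p>3 f σ b growing τ
  ) ,
  λ τ τ-lift → aCoeff-lift p p-prime p>3 f σ b growing τ τ-lift ,
               bCoeff-lift p p-prime p>3 f σ b growing τ τ-lift
  where
  b : ℤ
  b = bCoeff p 1 f σ
  growing : GrowingAt p (iterate f (Cycle.length σ)) (Cycle.elem σ zero) b
  growing = growing-base p f σ σ-grows
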